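{- Let $K$ be a field of characteristic different from $2$ and let $a,b,c,d\in K$ satisfy the non-degeneracy condition stated in the context. Let $\mathcal{K}^{\mathrm{gen}}(\mathcal{D})\subset\mathbf{P}^3$ (coordinates $k_1,k_2,k_3,k_4$) be the General Kummer surface of the genus $2$ curve $\mathcal{D}: y^2=x(x-1)(x-\rho)(x-\sigma)(x-\tau)$, let $\mathcal{K}^{\mathrm{fast}}\subset\mathbf{P}^3$ (coordinates $X,Y,Z,T$) be the Fast Kummer surface with parameters $a,b,c,d$, and let $P$ be the $4\times4$ matrix over $K$, all as defined in the context. Then the map $$\begin{pmatrix} X \\ Y \\ Z \\ T \end{pmatrix}=P^{ -1}\begin{pmatrix} k_1 \\ k_2 \\ k_3 \\ k_4 \end{pmatrix}$$ is a linear map from $\mathcal{K}^{\mathrm{gen}}(\mathcal{D})$ to $\mathcal{K}^{\mathrm{fast}}$.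
   Context: **Parameters.** For $a,b,c,d\in K$ put $A=a^2+b^2+c^2+d^2$, $B=a^2+b^2-c^2-d^2$, $C=a^2-b^2+c^2-d^2$, $D=a^2-b^2-c^2+d^2$, and $$E=\frac{abcd\,ABCD}{(a^2d^2-b^2c^2)(a^2c^2-b^2d^2)(a^2b^2-c^2d^2)},\quad F=\frac{a^4-b^4-c^4+d^4}{a^2d^2-b^2c^2},$$ $$G=\frac{a^4-b^4+c^4-d^4}{a^2c^2-b^2d^2},\quad H=\frac{a^4+b^4-c^4-d^4}{a^2b^2-c^2d^2}.$$ **Curve $\mathcal{D}$.** $\mathcal{D}: y^2=x(x-1)(x-\rho)(x-\sigma)(x-\tau)$ with $$\rho=\frac{CD}{AB},\quad \sigma=\frac{(ac+bd)C}{(ac-bd)A},\quad \tau=\frac{(ac+bd)D}{(ac-bd)B}.$$ Non-degeneracy condition: these quantities are defined (i.e. $A,B,ac-bd\neq0$) and $\infty,0,1,\rho,\sigma,\tau$ are pairwise distinct, so that $\mathcal{D}$ has genus $2$. **Fast Kummer surface.** $\mathcal{K}^{\mathrm{fast}}$ is $$X^4+Y^4+Z^4+T^4-F(X^2T^2+Y^2Z^2)-G(X^2Z^2+Y^2T^2)-H(X^2Y^2+Z^2T^2)+2E\,XYZT=0.$$ **General Kummer surface.** For a genus $2$ curve $y^2=f_6x^6+f_5x^5+\dots+f_1x+f_0$, the General Kummer surface is the quartic in $\mathbf{P}^3$ $$F_1k_4^2+F_2k_4+F_3=0,$$ where $F_1=k_2^2-4k_1k_3$, $F_2=-2(2k_1^3f_0+k_1^2k_2f_1+2k_1^2k_3f_2+k_1k_2k_3f_3+2k_1k_3^2f_4+k_2k_3^2f_5+2k_3^3f_6)$,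 $F_3=-4k_1^4f_0f_2+k_1^4f_1^2-4k_1^3k_2f_0f_3-2k_1^3k_3f_1f_3-4k_1^2k_2^2f_0f_4+4k_1^2k_2k_3f_0f_5-4k_1^2k_2k_3f_1f_4-4k_1^2k_3^2f_0f_6+2k_1^2k_3^2f_1f_5-4k_1^2k_3^2f_2f_4+k_1^2k_3^2f_3^2-4k_1k_2^3f_0f_5+8k_1k_2^2k_3f_0f_6-4k_2^4f_0f_6-4k_1k_2^2k_3f_1f_5+4k_1k_2k_3^2f_1f_6-4k_1k_2k_3^2f_2f_5-2k_1k_3^3f_3f_5-4k_2^3k_3f_1f_6-4k_2^2k_3^2f_2f_6-4k_2k_3^3f_3f_6-4k_3^4f_4f_6+k_3^4f_5^2$. $\mathcal{K}^{\mathrm{gen}}(\mathcal{D})$ is this surface with $f_6=0$ and $f_0,\dots,f_5$ the coefficients of $x(x-1)(x-\rho)(x-\sigma)(x-\tau)$. **Matrix $P$.** Put $n_1=ac-bd$, $n_2=ac+bd$, $m_1=c^2(a^4+b^4-c^4+d^4)-2a^2b^2d^2$, $m_2=d^2(a^4+b^4+c^4-d^4)-2a^2b^2c^2$, $m_3=a^2(a^4-b^4-c^4-d^4)+2b^2c^2d^2$, $m_4=b^2(a^4-b^4+c^4+d^4)-2a^2c^2d^2$, and $$P=\begin{pmatrix} c n_1^2A^2B^2 & -d n_1^2A^2B^2 & -a n_1^2A^2B^2 & b n_1^2A^2B^2 \\ 2a n_1AB m_1 & 2b n_1AB m_2 & -2c n_1AB m_3 & 2d n_1AB m_4 \\ c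 n_1n_2ABCD & d n_1n_2ABCD & -a n_1n_2ABCD & -b n_1n_2ABCD \\ 2a n_2CD m_1 & -2b n_2CD m_2 & -2c n_2CD m_3 & -2d n_2CD m_4 \end{pmatrix}.$$ That the displayed map "is a linear map from $\mathcal{K}^{\mathrm{gen}}(\mathcal{D})$ to $\mathcal{K}^{\mathrm{fast}}$" means that this linear change of coordinates on $\mathbf{P}^3$ converts the defining equation of $\mathcal{K}^{\mathrm{gen}}(\mathcal{D})$ into that of $\mathcal{K}^{\mathrm{fast}}$ (up to a nonzero constant factor). -}

module Defs where

open import Algebra.Apartness.Bundles using (HeytingCommutativeRing; HeytingField)
import Algebra.Apartness.Properties.HeytingCommutativeRing as HeytingProperties
open import Algebra.Bundles using (CommutativeRing; RawRing; Semiring)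
import Algebra.Definitions.RawSemiring as RawSemiringDefinitions
import Algebra.Properties.Ring as RingProperties
import Algebra.Properties.Semiring.Mult.TCOptimised as Multiples
import Algebra.Solver.Ring as RingSolver
import Algebra.Solver.Ring.AlmostCommutativeRing as ACR
open import Data.Fin.Base using (Fin)
open import Data.Fin.Patterns using (0F; 1F; 2F; 3F)
open import Data.Fin.Properties using (_≟_)
open import Data.Integer.Base as ℤ using (ℤ; +_; -[1+_])
import Data.Integer.Properties as ℤ
open import Data.List.Base using (List; []; _∷_)
open import Data.List.Relation.Unary.All using (All; []; _∷_)
open import Data.List.Relation.Unary.AllPairs using (AllPairs; []; _∷_)
open import Data.Maybe.Base using (Maybe; map)
open import Data.Nat.Base as ℕ using (ℕ; zero; suc)
open import Data.Product.Base using (_×_; ∃; _,_; proj₁; proj₂)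
open import Data.Sign.Base as Sign using (Sign)
open import Data.Vec.Base using (Vec; []; _∷_; lookup)
open import Level using (_⊔_)
open import Relation.Binary.Consequences using (dec⇒weaklyDec)
open import Relation.Binary.PropositionalEquality.Core using (_≡_; cong)
import Relation.Binary.Reasoning.Setoid as ≈-Reasoning
open import Relation.Nullary.Decidable.Core using (does)
open import Data.Bool.Base using (if_then_else_)

-- `n · x` is the n-fold sum of x; it binds weaker than _*_ and tighter than
-- _+_, so that `4 · x * y` is 4xy.
module RingNotation {r ℓ} (R : CommutativeRing r ℓ) where
  open CommutativeRing R public hiding (zero)
  open RawSemiringDefinitions (Semiring.rawSemiring semiring) public
    using (sum)
    renaming (_^′_ to infixr 8 _^_; _×′_ to infixr 6.5 _·_)

-- The solver for ring identities with integer coefficients.  It is used only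
-- to show that the denominators of the coefficients of the fast Kummer surface
-- do not vanish.
module IntegerCoefficients {r ℓ} (R : CommutativeRing r ℓ) where
  open CommutativeRing R hiding (zero)
  open RingProperties ring
  open Multiples semiring using (×-homo-+; ×1-homo-*; 1+×) renaming (_×_ to _×′_)
  open ≈-Reasoning setoid

  private
    signed : Sign → Carrier → Carrier
    signed Sign.+ x = x
    signed Sign.- x = - x

    ⟦_⟧ : ℤ → Carrier
    ⟦ i ⟧ = signed (ℤ.sign i) (ℤ.∣ i ∣ ×′ 1#)

    ◃-homo : ∀ s n → ⟦ s ℤ.◃ n ⟧ ≈ signed s (n ×′ 1#)
    ◃-homo Sign.+ zero    = refl
    ◃-homo Sign.- zero    = sym -0#≈0#
    ◃-homo Sign.+ (suc n) = refl
    ◃-homo Sign.- (suc n) = refl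

    signed-cong : ∀ s {x y} → x ≈ y → signed s x ≈ signed s y
    signed-cong Sign.+ p = p
    signed-cong Sign.- p = -‿cong p

    signed-* : ∀ s t x y → signed (s Sign.* t) (x * y) ≈ signed s x * signed t y
    signed-* Sign.+ Sign.+ x y = refl
    signed-* Sign.+ Sign.- x y = -‿distribʳ-* x y
    signed-* Sign.- Sign.+ x y = -‿distribˡ-* x y
    signed-* Sign.- Sign.- x y = begin
      x * y         ≈⟨ -‿involutive (x * y) ⟨
      - - (x * y)   ≈⟨ -‿cong (-‿distribʳ-* x y) ⟩
      - (x * - y)   ≈⟨ -‿distribˡ-* x (- y) ⟩
      - x * - y     ∎

    *-homo : ∀ i j → ⟦ i ℤ.* j ⟧ ≈ ⟦ i ⟧ * ⟦ j ⟧
    *-homo i j = begin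
      ⟦ s ℤ.◃ m ℕ.* n ⟧                   ≈⟨ ◃-homo s (m ℕ.* n) ⟩
      signed s ((m ℕ.* n) ×′ 1#)          ≈⟨ signed-cong s (×1-homo-* m n) ⟩
      signed s ((m ×′ 1#) * (n ×′ 1#))    ≈⟨ signed-* (ℤ.sign i) (ℤ.sign j) _ _ ⟩
      ⟦ i ⟧ * ⟦ j ⟧                       ∎
      where
      s = ℤ.sign i Sign.* ℤ.sign j
      m = ℤ.∣ i ∣
      n = ℤ.∣ j ∣

    -‿homo : ∀ i → ⟦ ℤ.- i ⟧ ≈ - ⟦ i ⟧
    -‿homo (+ zero)  = sym -0#≈0#
    -‿homo (+ suc n) = refl
    -‿homo -[1+ n ]  = sym (-‿involutive _)

    cancel : ∀ x y z → x + y - (x + z) ≈ y - z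
    cancel x y z = begin
      x + y - (x + z)      ≈⟨ +-cong (+-comm x y) (sym (-‿+-comm x z)) ⟩
      y + x + (- x - z)    ≈⟨ +-assoc y x _ ⟩
      y + (x + (- x - z))  ≈⟨ +-congˡ (+-assoc x (- x) (- z)) ⟨
      y + (x - x - z)      ≈⟨ +-congˡ (+-congʳ (-‿inverseʳ x)) ⟩
      y + (0# - z)         ≈⟨ +-congˡ (+-identityˡ (- z)) ⟩
      y - z                ∎

    ⊖-homo : ∀ m n → ⟦ m ℤ.⊖ n ⟧ ≈ m ×′ 1# - n ×′ 1#
    ⊖-homo m zero = begin
      m ×′ 1#         ≈⟨ +-identityʳ _ ⟨
      m ×′ 1# + 0#    ≈⟨ +-congˡ -0#≈0# ⟨
      m ×′ 1# - 0#    ∎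
    ⊖-homo zero (suc n) = sym (+-identityˡ _)
    ⊖-homo (suc m) (suc n) = begin
      ⟦ suc m ℤ.⊖ suc n ⟧                  ≡⟨ cong ⟦_⟧ (ℤ.[1+m]⊖[1+n]≡m⊖n m n) ⟩
      ⟦ m ℤ.⊖ n ⟧                          ≈⟨ ⊖-homo m n ⟩
      m ×′ 1# - n ×′ 1#                    ≈⟨ cancel 1# _ _ ⟨
      1# + m ×′ 1# - (1# + n ×′ 1#)        ≈⟨ +-cong (1+× m 1#) (-‿cong (1+× n 1#)) ⟨
      suc m ×′ 1# - suc n ×′ 1#            ∎

    +-homo : ∀ i j → ⟦ i ℤ.+ j ⟧ ≈ ⟦ i ⟧ + ⟦ j ⟧
    +-homo (+ m)    (+ n)    = ×-homo-+ 1# m n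
    +-homo (+ m)    -[1+ n ] = ⊖-homo m (suc n)
    +-homo -[1+ m ] (+ n)    = trans (⊖-homo n (suc m)) (+-comm _ _)
    +-homo -[1+ m ] -[1+ n ] = begin
      - (suc (suc (m ℕ.+ n)) ×′ 1#)        ≡⟨ cong (λ k → - (suc k ×′ 1#)) (+-suc m n) ⟨
      - ((suc m ℕ.+ suc n) ×′ 1#)          ≈⟨ -‿cong (×-homo-+ 1# (suc m) (suc n)) ⟩
      - (suc m ×′ 1# + suc n ×′ 1#)        ≈⟨ -‿+-comm _ _ ⟨
      - (suc m ×′ 1#) - suc n ×′ 1#        ∎
      where open import Data.Nat.Properties using (+-suc)

    ℤ-ring : RawRing _ _
    ℤ-ring = record
      { Carrier = ℤ ; _≈_ = _≡_ ; _+_ = ℤ._+_ ; _*_ = ℤ._*_ ; -_ = ℤ.-_ ; 0# = ℤ.0ℤ ; 1# = ℤ.1ℤ }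

    homomorphism : ℤ-ring ACR.-Raw-AlmostCommutative⟶ ACR.fromCommutativeRing R
    homomorphism = record
      { ⟦_⟧ = ⟦_⟧ ; +-homo = +-homo ; *-homo = *-homo ; -‿homo = -‿homo
      ; 0-homo = refl ; 1-homo = refl }

    decide : ∀ i j → Maybe (⟦ i ⟧ ≈ ⟦ j ⟧)
    decide i j = map (λ i≡j → reflexive (cong ⟦_⟧ i≡j)) (dec⇒weaklyDec ℤ._≟_ i j)

  open RingSolver ℤ-ring (ACR.fromCommutativeRing R) homomorphism decide public
    using (solve; _:=_; _:+_; _:*_; _:-_; con)

-- The polynomial ring R[x₀, …, xₙ₋₁], presented as the free commutative
-- R-algebra on n generators: expressions modulo the commutative ring axioms
-- and the requirement that `con` be a ring homomorphism.  Equality is thus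
-- equality of formal polynomials, not of polynomial functions (the two differ
-- over a finite field).
module PolynomialRing {r ℓ} (R : CommutativeRing r ℓ) (n : ℕ) where
  private module R = CommutativeRing R

  infix  8 :-_
  infixl 7 _:*_
  infixl 6 _:+_
  infix  4 _≈ₚ_

  data Poly : Set r where
    con       : R.Carrier → Poly
    var       : Fin n → Poly
    _:+_ _:*_ : Poly → Poly → Poly
    :-_       : Poly → Poly

  data _≈ₚ_ : Poly → Poly → Set (r ⊔ ℓ) where
    refl  : ∀ {p} → p ≈ₚ p
    sym   : ∀ {p q} → p ≈ₚ q → q ≈ₚ p
    trans : ∀ {p q s} → p ≈ₚ q → q ≈ₚ s → p ≈ₚ s

    +-cong : ∀ {p p′ q q′} → p ≈ₚ p′ → q ≈ₚ q′ → p :+ q ≈ₚ p′ :+ q′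
    *-cong : ∀ {p p′ q q′} → p ≈ₚ p′ → q ≈ₚ q′ → p :* q ≈ₚ p′ :* q′
    -‿cong : ∀ {p p′} → p ≈ₚ p′ → :- p ≈ₚ :- p′

    +-assoc     : ∀ p q s → (p :+ q) :+ s ≈ₚ p :+ (q :+ s)
    +-comm      : ∀ p q → p :+ q ≈ₚ q :+ p
    +-identityˡ : ∀ p → con R.0# :+ p ≈ₚ p
    -‿inverseˡ  : ∀ p → :- p :+ p ≈ₚ con R.0#
    *-assoc     : ∀ p q s → (p :* q) :* s ≈ₚ p :* (q :* s)
    *-comm      : ∀ p q → p :* q ≈ₚ q :* p
    *-identityˡ : ∀ p → con R.1# :* p ≈ₚ p
    distribˡ    : ∀ p q s → p :* (q :+ s) ≈ₚ p :* q :+ p :* s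

    con-cong   : ∀ {x y} → x R.≈ y → con x ≈ₚ con y
    con-+-homo : ∀ x y → con (x R.+ y) ≈ₚ con x :+ con y
    con-*-homo : ∀ x y → con (x R.* y) ≈ₚ con x :* con y

  polynomialRing : CommutativeRing r (r ⊔ ℓ)
  polynomialRing = record
    { Carrier = Poly
    ; _≈_     = _≈ₚ_
    ; _+_     = _:+_
    ; _*_     = _:*_
    ; -_      = :-_
    ; 0#      = con R.0#
    ; 1#      = con R.1#
    ; isCommutativeRing = record
      { isRing = record
        { +-isAbelianGroup = record
          { isGroup = record
            { isMonoid = record
              { isSemigroup = record
                { isMagma = record
                  { isEquivalence = record { refl = refl ; sym = sym ; trans = trans }
                  ; ∙-cong        = +-cong
                  }
                ; assoc = +-assoc
                }
              ; identity = +-identityˡ , λ p → trans (+-comm _ _) (+-identityˡ p)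
              }
            ; inverse = -‿inverseˡ , λ p → trans (+-comm _ _) (-‿inverseˡ p)
            ; ⁻¹-cong = -‿cong
            }
          ; comm = +-comm
          }
        ; *-cong     = *-cong
        ; *-assoc    = *-assoc
        ; *-identity = *-identityˡ , λ p → trans (*-comm _ _) (*-identityˡ p)
        ; distrib    = distribˡ , λ p q s →
            trans (*-comm _ _) (trans (distribˡ p q s) (+-cong (*-comm _ _) (*-comm _ _)))
        }
      ; *-comm = *-comm
      }
    }

  substitute : (Fin n → Poly) → Poly → Poly
  substitute f (con x)  = con x
  substitute f (var i)  = f i
  substitute f (p :+ q) = substitute f p :+ substitute f q
  substitute f (p :* q) = substitute f p :* substitute f q
  substitute f (:- p)   = :- substitute f p

module Matrices {r ℓ} (R : CommutativeRing r ℓ) (n : ℕ) where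
  open RingNotation R

  Matrix : Set r
  Matrix = Fin n → Fin n → Carrier

  identity : Matrix
  identity i j = if does (i ≟ j) then 1# else 0#

  infixl 7 _⊗_
  _⊗_ : Matrix → Matrix → Matrix
  (M ⊗ N) i j = sum (λ k → M i k * N k j)

  AreInverse : Matrix → Matrix → Set ℓ
  AreInverse M N = (∀ i j → (M ⊗ N) i j ≈ identity i j) × (∀ i j → (N ⊗ M) i j ≈ identity i j)

module QuarticForms {r ℓ} (R : CommutativeRing r ℓ) where
  open RingNotation R

  module _ (f₀ f₁ f₂ f₃ f₄ f₅ f₆ k₁ k₂ k₃ k₄ : Carrier) where

    F₁ F₂ F₃ generalForm : Carrier

    F₁ = k₂ ^ 2 - 4 · k₁ * k₃

    F₂ = - (2 · ( 2 · k₁ ^ 3 * f₀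
                + k₁ ^ 2 * k₂ * f₁
                + 2 · k₁ ^ 2 * k₃ * f₂
                + k₁ * k₂ * k₃ * f₃
                + 2 · k₁ * k₃ ^ 2 * f₄
                + k₂ * k₃ ^ 2 * f₅
                + 2 · k₃ ^ 3 * f₆ ))

    F₃ = - (4 · k₁ ^ 4 * f₀ * f₂)
       + k₁ ^ 4 * f₁ ^ 2
       - 4 · k₁ ^ 3 * k₂ * f₀ * f₃
       - 2 · k₁ ^ 3 * k₃ * f₁ * f₃
       - 4 · k₁ ^ 2 * k₂ ^ 2 * f₀ * f₄
       + 4 · k₁ ^ 2 * k₂ * k₃ * f₀ * f₅
       - 4 · k₁ ^ 2 * k₂ * k₃ * f₁ * f₄
       - 4 · k₁ ^ 2 * k₃ ^ 2 * f₀ * f₆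
       + 2 · k₁ ^ 2 * k₃ ^ 2 * f₁ * f₅
       - 4 · k₁ ^ 2 * k₃ ^ 2 * f₂ * f₄
       + k₁ ^ 2 * k₃ ^ 2 * f₃ ^ 2
       - 4 · k₁ * k₂ ^ 3 * f₀ * f₅
       + 8 · k₁ * k₂ ^ 2 * k₃ * f₀ * f₆
       - 4 · k₂ ^ 4 * f₀ * f₆
       - 4 · k₁ * k₂ ^ 2 * k₃ * f₁ * f₅
       + 4 · k₁ * k₂ * k₃ ^ 2 * f₁ * f₆
       - 4 · k₁ * k₂ * k₃ ^ 2 * f₂ * f₅
       - 2 · k₁ * k₃ ^ 3 * f₃ * f₅
       - 4 · k₂ ^ 3 * k₃ * f₁ * f₆
       - 4 · k₂ ^ 2 * k₃ ^ 2 * f₂ * f₆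
       - 4 · k₂ * k₃ ^ 3 * f₃ * f₆
       - 4 · k₃ ^ 4 * f₄ * f₆
       + k₃ ^ 4 * f₅ ^ 2

    generalForm = F₁ * k₄ ^ 2 + F₂ * k₄ + F₃

  fastForm : (E F G H X Y Z T : Carrier) → Carrier
  fastForm E F G H X Y Z T =
      X ^ 4 + Y ^ 4 + Z ^ 4 + T ^ 4
    - F * (X ^ 2 * T ^ 2 + Y ^ 2 * Z ^ 2)
    - G * (X ^ 2 * Z ^ 2 + Y ^ 2 * T ^ 2)
    - H * (X ^ 2 * Y ^ 2 + Z ^ 2 * T ^ 2)
    + 2 · E * X * Y * Z * T

-- A field is a Heyting field: `x # 0#` says that x is nonzero, in the positive
-- sense that x is invertible.  Every classical field is one, with x # y
-- meaning ¬ (x ≈ y).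
module Kummer {k ℓ₁ ℓ₂} (K : HeytingField k ℓ₁ ℓ₂) where

  open HeytingField K public using (_#_; #-sym; #⇒invertible; invertible⇒#; heytingCommutativeRing)
  open HeytingCommutativeRing heytingCommutativeRing public using (commutativeRing)
  open RingNotation commutativeRing public
  open PolynomialRing commutativeRing 4 public
    using (Poly; con; var; _:*_; _≈ₚ_; polynomialRing; substitute)
  open Matrices commutativeRing 4 public
  open HeytingProperties heytingCommutativeRing using (x-0≈x; invertibleˡ⇒#; x#0y#0→xy#0; #-congʳ)
  open RingProperties ring using (x[y-z]≈xy-xz)
  private
    module KX = RingNotation polynomialRing
    module S = IntegerCoefficients commutativeRing
  open S using (solve; _:=_) renaming (_:+_ to _⊕_; _:*_ to _⊛_; _:-_ to _⊝_)

  Characteristic≢2 : Set ℓ₂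
  Characteristic≢2 = 1# + 1# # 0#

  reciprocal : ∀ {x} → x # 0# → Carrier
  reciprocal x#0 = proj₁ (#⇒invertible x#0)

  infixl 7 _/_[_]
  _/_[_] : Carrier → ∀ y → y # 0# → Carrier
  x / y [ y#0 ] = x * reciprocal y#0

  -- coefficients (r₁ ∷ … ∷ rₘ ∷ []) i is the coefficient of xⁱ in
  -- (x - r₁) ⋯ (x - rₘ).
  coefficients : List Carrier → ℕ → Carrier
  coefficients []       zero    = 1#
  coefficients []       (suc i) = 0#
  coefficients (r ∷ rs) zero    = - (r * coefficients rs zero)
  coefficients (r ∷ rs) (suc i) = coefficients rs i - r * coefficients rs (suc i)

  -- p ∘ˡ M is p(Mx), where x is the column vector of the variables.
  infixl 7 _∘ˡ_
  _∘ˡ_ : Poly → Matrix → Poly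
  p ∘ˡ M = substitute (λ i → KX.sum (λ j → con (M i j) :* var j)) p

  -- The change of coordinates y = Mx turns the equation p(x) = 0 into
  -- p(M⁻¹y) = 0, which has to be q(y) = 0 up to a nonzero constant.
  infix 4 _isLinearMapFrom_to_
  _isLinearMapFrom_to_ : Matrix → Poly → Poly → Set (k ⊔ ℓ₁ ⊔ ℓ₂)
  M isLinearMapFrom p to q =
    ∃ λ M⁻¹ → AreInverse M M⁻¹ × ∃ λ c → c # 0# × p ∘ˡ M⁻¹ ≈ₚ con c :* q

  private
    reciprocalʳ : ∀ {x} (x#0 : x # 0#) → x * reciprocal x#0 ≈ 1#
    reciprocalʳ {x} x#0 =
      trans (*-congʳ (sym (x-0≈x x))) (proj₂ (proj₂ (#⇒invertible x#0)))

    /-cancel : ∀ x y (y#0 : y # 0#) → y * (x / y [ y#0 ]) ≈ x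
    /-cancel x y y#0 = trans (lemma y x (reciprocal y#0))
      (trans (*-congˡ (reciprocalʳ y#0)) (*-identityʳ x))
      where
      lemma : ∀ y x r → y * (x * r) ≈ x * (y * r)
      lemma = solve 3 (λ y x r → y ⊛ (x ⊛ r) := x ⊛ (y ⊛ r)) refl

    #0-factorˡ : ∀ {x y} → x * y # 0# → x # 0#
    #0-factorˡ {x} {y} xy#0 = invertibleˡ⇒# (y * reciprocal xy#0 , (begin
      y * reciprocal xy#0 * (x - 0#)    ≈⟨ *-congˡ (x-0≈x x) ⟩
      y * reciprocal xy#0 * x           ≈⟨ lemma x y (reciprocal xy#0) ⟩
      x * y * reciprocal xy#0           ≈⟨ reciprocalʳ xy#0 ⟩
      1#                                ∎))
      where
      open ≈-Reasoning setoid
      lemma : ∀ x y r → y * r * x ≈ x * y * r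
      lemma = solve 3 (λ x y r → y ⊛ r ⊛ x := x ⊛ y ⊛ r) refl

    #⇒-#0 : ∀ {x y} → x # y → x - y # 0#
    #⇒-#0 {x} {y} x#y with #⇒invertible x#y
    ... | r , r[x-y]≈1 , _ = invertibleˡ⇒# (r , trans (*-congˡ (x-0≈x (x - y))) r[x-y]≈1)

  module Parameters (a b c d : Carrier) where

    A B C D n₁ n₂ m₁ m₂ m₃ m₄ : Carrier
    A = a ^ 2 + b ^ 2 + c ^ 2 + d ^ 2
    B = a ^ 2 + b ^ 2 - c ^ 2 - d ^ 2
    C = a ^ 2 - b ^ 2 + c ^ 2 - d ^ 2
    D = a ^ 2 - b ^ 2 - c ^ 2 + d ^ 2
    n₁ = a * c - b * d
    n₂ = a * c + b * d
    m₁ = c ^ 2 * (a ^ 4 + b ^ 4 - c ^ 4 + d ^ 4) - 2 · a ^ 2 * b ^ 2 * d ^ 2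
    m₂ = d ^ 2 * (a ^ 4 + b ^ 4 + c ^ 4 - d ^ 4) - 2 · a ^ 2 * b ^ 2 * c ^ 2
    m₃ = a ^ 2 * (a ^ 4 - b ^ 4 - c ^ 4 - d ^ 4) + 2 · b ^ 2 * c ^ 2 * d ^ 2
    m₄ = b ^ 2 * (a ^ 4 - b ^ 4 + c ^ 4 + d ^ 4) - 2 · a ^ 2 * c ^ 2 * d ^ 2

    P : Matrix
    P i j = lookup (lookup rows i) j
      where
      rows : Vec (Vec Carrier 4) 4
      rows =
        (    c * n₁ ^ 2 * A ^ 2 * B ^ 2   ∷ - (d * n₁ ^ 2 * A ^ 2 * B ^ 2)
          ∷ - (a * n₁ ^ 2 * A ^ 2 * B ^ 2) ∷    b * n₁ ^ 2 * A ^ 2 * B ^ 2  ∷ [] ) ∷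
        (   (2 · a * n₁ * A * B * m₁)     ∷   (2 · b * n₁ * A * B * m₂)
          ∷ - (2 · c * n₁ * A * B * m₃)   ∷   (2 · d * n₁ * A * B * m₄)     ∷ [] ) ∷
        (    c * n₁ * n₂ * A * B * C * D   ∷    d * n₁ * n₂ * A * B * C * D
          ∷ - (a * n₁ * n₂ * A * B * C * D) ∷ - (b * n₁ * n₂ * A * B * C * D) ∷ [] ) ∷
        (   (2 · a * n₂ * C * D * m₁)     ∷ - (2 · b * n₂ * C * D * m₂)
          ∷ - (2 · c * n₂ * C * D * m₃)   ∷ - (2 · d * n₂ * C * D * m₄)     ∷ [] ) ∷ []

    -- The branch points of 𝒟 are those listed and ∞, which differs from each
    -- of them automatically.
    record NonDegenerate : Set (k ⊔ ℓ₂) where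
      field
        A#0  : A # 0#
        B#0  : B # 0#
        n₁#0 : n₁ # 0#

      ρ : Carrier
      ρ = C * D / (A * B) [ x#0y#0→xy#0 A#0 B#0 ]

      σ : Carrier
      σ = n₂ * C / (n₁ * A) [ x#0y#0→xy#0 n₁#0 A#0 ]

      τ : Carrier
      τ = n₂ * D / (n₁ * B) [ x#0y#0→xy#0 n₁#0 B#0 ]

      finiteBranchPoints : List Carrier
      finiteBranchPoints = 0# ∷ 1# ∷ ρ ∷ σ ∷ τ ∷ []

      field
        distinct : AllPairs _#_ finiteBranchPoints

    δF δG δH : Carrier
    δF = a ^ 2 * d ^ 2 - b ^ 2 * c ^ 2
    δG = a ^ 2 * c ^ 2 - b ^ 2 * d ^ 2
    δH = a ^ 2 * b ^ 2 - c ^ 2 * d ^ 2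

    module Surfaces (nondegenerate : NonDegenerate) where
      open NonDegenerate nondegenerate

      private
        n₁A#0 : n₁ * A # 0#
        n₁A#0 = x#0y#0→xy#0 n₁#0 A#0

        n₁B#0 : n₁ * B # 0#
        n₁B#0 = x#0y#0→xy#0 n₁#0 B#0

        AB#0 : A * B # 0#
        AB#0 = x#0y#0→xy#0 A#0 B#0

        n₂#0 : n₂ # 0#
        n₂#0 with distinct
        ... | (_ ∷ _ ∷ 0#σ ∷ _) ∷ _ =
          #0-factorˡ (#-congʳ (/-cancel _ _ n₁A#0) (x#0y#0→xy#0 n₁A#0 (#-sym 0#σ)))

      δF#0 : δF # 0#
      δF#0 with distinct
      ... | _ ∷ _ ∷ _ ∷ (σ#τ ∷ _) ∷ _ =
        #0-factorˡ (#-congʳ equation (x#0y#0→xy#0 (x#0y#0→xy#0 n₁A#0 n₁B#0) (#⇒-#0 σ#τ)))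
        where
        open ≈-Reasoning setoid
        clear : ∀ x y s t → x * y * (s - t) ≈ y * (x * s) - x * (y * t)
        clear = solve 4 (λ x y s t → x ⊛ y ⊛ (s ⊝ t) := y ⊛ (x ⊛ s) ⊝ x ⊛ (y ⊛ t)) refl
        equation : n₁ * A * (n₁ * B) * (σ - τ) ≈ δF * _
        equation = begin
          n₁ * A * (n₁ * B) * (σ - τ)
            ≈⟨ clear (n₁ * A) (n₁ * B) σ τ ⟩
          n₁ * B * (n₁ * A * σ) - n₁ * A * (n₁ * B * τ)
            ≈⟨ +-cong (*-congˡ (/-cancel _ _ n₁A#0)) (-‿cong (*-congˡ (/-cancel _ _ n₁B#0))) ⟩
          n₁ * B * (n₂ * C) - n₁ * A * (n₂ * D)
            ≈⟨ solve 6 (λ p q r s n m →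
                 n ⊛ (p ⊕ q ⊝ r ⊝ s) ⊛ (m ⊛ (p ⊝ q ⊕ r ⊝ s))
                   ⊝ n ⊛ (p ⊕ q ⊕ r ⊕ s) ⊛ (m ⊛ (p ⊝ q ⊝ r ⊕ s))
                 := (p ⊛ s ⊝ q ⊛ r) ⊛ (S.con -[1+ 3 ] ⊛ n ⊛ m))
                 refl (a ^ 2) (b ^ 2) (c ^ 2) (d ^ 2) n₁ n₂ ⟩
          δF * _ ∎

      δG#0 : δG # 0#
      δG#0 = #-congʳ (factorisation a b c d) (x#0y#0→xy#0 n₁#0 n₂#0)
        where
        factorisation : ∀ a b c d → (a * c - b * d) * (a * c + b * d) ≈ a ^ 2 * c ^ 2 - b ^ 2 * d ^ 2
        factorisation = solve 4 (λ a b c d → (a ⊛ c ⊝ b ⊛ d) ⊛ (a ⊛ c ⊕ b ⊛ d)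
          := (a ⊛ a) ⊛ (c ⊛ c) ⊝ (b ⊛ b) ⊛ (d ⊛ d)) refl

      δH#0 : δH # 0#
      δH#0 with distinct
      ... | _ ∷ (1#ρ ∷ _) ∷ _ =
        #0-factorˡ (#-congʳ equation (x#0y#0→xy#0 AB#0 (#⇒-#0 1#ρ)))
        where
        open ≈-Reasoning setoid
        equation : A * B * (1# - ρ) ≈ δH * _
        equation = begin
          A * B * (1# - ρ)             ≈⟨ x[y-z]≈xy-xz _ _ _ ⟩
          A * B * 1# - A * B * ρ       ≈⟨ +-cong (*-identityʳ _) (-‿cong (/-cancel _ _ AB#0)) ⟩
          A * B - C * D
            ≈⟨ solve 4 (λ p q r s →
                 (p ⊕ q ⊕ r ⊕ s) ⊛ (p ⊕ q ⊝ r ⊝ s) ⊝ (p ⊝ q ⊕ r ⊝ s) ⊛ (p ⊝ q ⊝ r ⊕ s)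
                 := (p ⊛ q ⊝ r ⊛ s) ⊛ S.con (+ 4))
                 refl (a ^ 2) (b ^ 2) (c ^ 2) (d ^ 2) ⟩
          δH * _ ∎

      E F G H : Carrier
      E = a * b * c * d * A * B * C * D / (δF * δG * δH) [ x#0y#0→xy#0 (x#0y#0→xy#0 δF#0 δG#0) δH#0 ]
      F = (a ^ 4 - b ^ 4 - c ^ 4 + d ^ 4) / δF [ δF#0 ]
      G = (a ^ 4 - b ^ 4 + c ^ 4 - d ^ 4) / δG [ δG#0 ]
      H = (a ^ 4 + b ^ 4 - c ^ 4 - d ^ 4) / δH [ δH#0 ]

      open QuarticForms polynomialRing

      𝒦ᵍᵉⁿ : Poly
      𝒦ᵍᵉⁿ = generalForm (con (f 0)) (con (f 1)) (con (f 2)) (con (f 3)) (con (f 4)) (con (f 5))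
               (con 0#) (var 0F) (var 1F) (var 2F) (var 3F)
        where
        f : ℕ → Carrier
        f = coefficients finiteBranchPoints

      𝒦ᶠᵃˢᵗ : Poly
      𝒦ᶠᵃˢᵗ = fastForm (con E) (con F) (con G) (con H) (var 0F) (var 1F) (var 2F) (var 3F)

{-# OPTIONS --safe #-}
module Submission where

open import Defs
open import Algebra.Apartness.Bundles using (HeytingField)
import Algebra.Apartness.Properties.HeytingCommutativeRing as HeytingProperties
open import Algebra.Bundles using (CommutativeRing)
import Algebra.Properties.CommutativeSemigroup as CommutativeSemigroupProperties
import Algebra.Properties.Ring as RingProperties
import Algebra.Properties.Semiring.Mult.TCOptimised as Multiples
import Algebra.Properties.Semiring.Sum as Sums
open import Data.Fin.Base using (Fin)
open import Data.Fin.Patterns using (0F; 1F; 2F; 3F; 4F; 5F; 6F; 7F; 8F; 9F)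
open import Data.Fin using (#_)
import Data.Integer.Base as ℤ
open import Data.List.Base using (List; []; _∷_)
open import Data.List.Relation.Unary.All using (_∷_)
open import Data.List.Relation.Unary.AllPairs using (_∷_)
open import Data.Maybe.Base using (nothing)
open import Data.Nat.Base as ℕ using (ℕ; zero; suc; _≡ᵇ_)
import Data.Nat.Properties as ℕ
open import Data.Product.Base using (_×_; ∃; _,_; proj₁; proj₂)
open import Data.Unit.Base using (⊤)
open import Data.Vec.Base as Vec using (Vec; []; _∷_; _++_; lookup)
import Data.Vec.Properties as Vec
open import Data.Vec.Relation.Binary.Pointwise.Inductive as Pointwise using (Pointwise; []; _∷_)
open import Level using (0ℓ)
open import Relation.Binary.PropositionalEquality.Core as ≡ using (_≡_)
import Relation.Binary.Reasoning.Setoid as ≈-Reasoning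
import Tactic.RingSolver.Core.Polynomial.Base as Horner
import Tactic.RingSolver.Core.Polynomial.Homomorphism as HornerHomomorphism
import Tactic.RingSolver.Core.Polynomial.Homomorphism.Lemmas as HornerLemmas
open import Tactic.RingSolver.Core.Polynomial.Parameters using (RawCoeff; Homomorphism)
import Tactic.RingSolver.Core.Polynomial.Semantics as HornerSemantics

-- Put e = n₁AB, g = n₂CD and
--   u = cX - aZ,  v = dY - bT,  p = 2(am₁X - cm₃Z),  q = 2(bm₂Y + dm₄T).
-- Then (k₁, k₂, k₃, k₄) = P(X, Y, Z, T) reads
--   k₁ = e²(u - v),  k₂ = e(p + q),  k₃ = eg(u + v),  k₄ = g(p - q).
-- With x = C/A, y = D/B and ν = n₂/n₁ the branch points are 0, 1, xy, νx, νy
-- and g = eνxy, so that all denominators cancel: the general Kummer form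
-- becomes (eg)² times a quartic form in u, v, p, q whose coefficients are
-- polynomials in n₁, n₂, A, B, C, D.  As a form in X, Y, Z, T, the latter is
-- -256 δF³ δG δH³ times the fast form, which is an identity in ℤ[a,…,d,X,…,T].
-- P is inverted by passing through u, v, p, q: the two blocks expressing
-- (u , p) by (X , Z) and (v , q) by (Y , T) have determinants ∓4 δF δH.

-- Integer polynomial identities, checked by normal forms

data Term (n : ℕ) : Set where
  zero one : Term n
  var      : Fin n → Term n
  add mul  : Term n → Term n → Term n
  neg      : Term n → Term n

-- Any two terms count as equal: the ring structure only serves to apply the
-- definitions for commutative rings to syntax.
termRing : ℕ → CommutativeRing 0ℓ 0ℓ
termRing n = record
  { Carrier = Term n ; _≈_ = λ _ _ → ⊤ ; _+_ = add ; _*_ = mul ; -_ = neg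
  ; 0# = zero ; 1# = one ; isCommutativeRing = _ }

-- The pair (m , n) stands for the integer m - n.
differences : RawCoeff 0ℓ 0ℓ
differences = record
  { rawRing = record
    { Carrier = ℕ × ℕ
    ; _≈_     = λ { (m , n) (p , q) → m ℕ.+ q ≡ p ℕ.+ n }
    ; _+_     = λ { (m , n) (p , q) → m ℕ.+ p , n ℕ.+ q }
    ; _*_     = λ { (m , n) (p , q) → m ℕ.* p ℕ.+ n ℕ.* q , m ℕ.* q ℕ.+ n ℕ.* p }
    ; -_      = λ { (m , n) → n , m }
    ; 0#      = 0 , 0
    ; 1#      = 1 , 0
    }
  ; isZero = λ x → proj₁ x ≡ᵇ proj₂ x
  }

open Horner differences
  using (Zero; κ; ι; _⊞_; _⊠_; ⊟_)
  renaming (Poly to HornerForm)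

normalise : ∀ {n} → Term n → HornerForm n
normalise zero      = κ (0 , 0)
normalise one       = κ (1 , 0)
normalise (var i)   = ι i
normalise (add s t) = normalise s ⊞ normalise t
normalise (mul s t) = normalise s ⊠ normalise t
normalise (neg t)   = ⊟ normalise t

-- A data type rather than a synonym for `Zero …`: otherwise every reduction of
-- the type s ≋ t would recompute the normal forms.
infix 4 _≋_
data _≋_ {n} (s t : Term n) : Set where
  normalised : Zero (normalise s ⊞ ⊟ normalise t) → s ≋ t

-- Evaluation of terms in commutative rings

module Evaluation {r ℓ} (R : CommutativeRing r ℓ) where
  open CommutativeRing R hiding (zero)
  open RingProperties ring
  open Multiples semiring using (×-homo-+; ×1-homo-*) renaming (_×_ to _×′_)
  open IntegerCoefficients R
  open ≈-Reasoning setoid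

  ⟦_⟧ : ∀ {n} → Term n → Vec Carrier n → Carrier
  ⟦ zero ⟧    ρ = 0#
  ⟦ one ⟧     ρ = 1#
  ⟦ var i ⟧   ρ = Vec.lookup ρ i
  ⟦ add s t ⟧ ρ = ⟦ s ⟧ ρ + ⟦ t ⟧ ρ
  ⟦ mul s t ⟧ ρ = ⟦ s ⟧ ρ * ⟦ t ⟧ ρ
  ⟦ neg t ⟧   ρ = - ⟦ t ⟧ ρ

  -- Rewrites all arguments of a large form at once, whatever the shape of the form.
  ⟦⟧-cong : ∀ {n} (t : Term n) {ρ σ} → Pointwise _≈_ ρ σ → ⟦ t ⟧ ρ ≈ ⟦ t ⟧ σ
  ⟦⟧-cong zero      ρ≈σ = refl
  ⟦⟧-cong one       ρ≈σ = refl
  ⟦⟧-cong (var i)   ρ≈σ = Pointwise.lookup ρ≈σ i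
  ⟦⟧-cong (add s t) ρ≈σ = +-cong (⟦⟧-cong s ρ≈σ) (⟦⟧-cong t ρ≈σ)
  ⟦⟧-cong (mul s t) ρ≈σ = *-cong (⟦⟧-cong s ρ≈σ) (⟦⟧-cong t ρ≈σ)
  ⟦⟧-cong (neg t)   ρ≈σ = -‿cong (⟦⟧-cong t ρ≈σ)

  private
    ⟪_⟫ : ℕ × ℕ → Carrier
    ⟪ m , n ⟫ = m ×′ 1# - n ×′ 1#

    +-homo : ∀ m n p q → ⟪ m ℕ.+ p , n ℕ.+ q ⟫ ≈ ⟪ m , n ⟫ + ⟪ p , q ⟫
    +-homo m n p q = begin
      ⟪ m ℕ.+ p , n ℕ.+ q ⟫
        ≈⟨ +-cong (×-homo-+ 1# m p) (-‿cong (×-homo-+ 1# n q)) ⟩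
      (m ×′ 1# + p ×′ 1#) - (n ×′ 1# + q ×′ 1#)
        ≈⟨ solve 4 (λ m n p q → m :+ p :- (n :+ q) := (m :- n) :+ (p :- q)) refl _ _ _ _ ⟩
      ⟪ m , n ⟫ + ⟪ p , q ⟫ ∎

    *-homo : ∀ m n p q →
             ⟪ m ℕ.* p ℕ.+ n ℕ.* q , m ℕ.* q ℕ.+ n ℕ.* p ⟫ ≈ ⟪ m , n ⟫ * ⟪ p , q ⟫
    *-homo m n p q = begin
      ⟪ m ℕ.* p ℕ.+ n ℕ.* q , m ℕ.* q ℕ.+ n ℕ.* p ⟫
        ≈⟨ +-homo (m ℕ.* p) (m ℕ.* q) (n ℕ.* q) (n ℕ.* p) ⟩
      ⟪ m ℕ.* p , m ℕ.* q ⟫ + ⟪ n ℕ.* q , n ℕ.* p ⟫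
        ≈⟨ +-cong (+-cong (×1-homo-* m p) (-‿cong (×1-homo-* m q)))
                  (+-cong (×1-homo-* n q) (-‿cong (×1-homo-* n p))) ⟩
      _ ≈⟨ solve 4 (λ m n p q → (m :* p :- m :* q) :+ (n :* q :- n :* p) := (m :- n) :* (p :- q))
             refl (m ×′ 1#) (n ×′ 1#) (p ×′ 1#) (q ×′ 1#) ⟩
      ⟪ m , n ⟫ * ⟪ p , q ⟫ ∎

    -‿homo : ∀ m n → ⟪ n , m ⟫ ≈ - ⟪ m , n ⟫
    -‿homo m n = +-inverseˡ-unique _ _
      (solve 2 (λ m n → n :- m :+ (m :- n) := con ℤ.0ℤ) refl (m ×′ 1#) (n ×′ 1#))

    homomorphism : Homomorphism 0ℓ 0ℓ r ℓ
    homomorphism = record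
      { from = differences
      ; to = record
        -- `R` need not have a decidable equality; vanishing is tested on the coefficient pairs
        -- only.
        { 0≟_ = λ _ → nothing
        ; isAlmostCommutativeRing = record
          { isCommutativeSemiring = isCommutativeSemiring
          ; -‿cong                = -‿cong
          ; -‿*-distribˡ          = λ x y → sym (-‿distribˡ-* x y)
          ; -‿+-comm              = -‿+-comm
          }
        }
      ; morphism = record
        { ⟦_⟧    = ⟪_⟫
        ; +-homo = λ { (m , n) (p , q) → +-homo m n p q }
        ; *-homo = λ { (m , n) (p , q) → *-homo m n p q }
        ; -‿homo = λ { (m , n) → -‿homo m n }
        ; 0-homo = -‿inverseʳ 0#
        ; 1-homo = trans (+-congˡ -0#≈0#) (+-identityʳ 1#)
        }
      ; Zero-C⟶Zero-R = λ { (m , n) m≡ᵇn → sym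
          (trans (+-congʳ (reflexive (≡.cong (_×′ 1#) (ℕ.≡ᵇ⇒≡ m n m≡ᵇn)))) (-‿inverseʳ (n ×′ 1#))) }
      }

    open HornerSemantics homomorphism renaming (⟦_⟧ to ⟦_⟧ₚ)
    open HornerHomomorphism homomorphism using (κ-hom; ι-hom; ⊞-hom; ⊠-hom; ⊟-hom)

    normalise-correct : ∀ {n} (t : Term n) ρ → ⟦ normalise t ⟧ₚ ρ ≈ ⟦ t ⟧ ρ
    normalise-correct zero      ρ = trans (κ-hom (0 , 0) ρ) (-‿inverseʳ 0#)
    normalise-correct one       ρ = trans (κ-hom (1 , 0) ρ) (trans (+-congˡ -0#≈0#) (+-identityʳ 1#))
    normalise-correct (var i)   ρ = ι-hom i ρ
    normalise-correct (add s t) ρ = trans (⊞-hom (normalise s) (normalise t) ρ)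
      (+-cong (normalise-correct s ρ) (normalise-correct t ρ))
    normalise-correct (mul s t) ρ = trans (⊠-hom (normalise s) (normalise t) ρ)
      (*-cong (normalise-correct s ρ) (normalise-correct t ρ))
    normalise-correct (neg t)   ρ = trans (⊟-hom (normalise t) ρ) (-‿cong (normalise-correct t ρ))

  -- Normal forms are computed over the integers, so one check serves every commutative ring of
  -- every characteristic; it is applied both in `K` and in the polynomial ring over `K`.
  ⟦⟧-sound : ∀ {n} (s t : Term n) → s ≋ t → ∀ ρ → ⟦ s ⟧ ρ ≈ ⟦ t ⟧ ρ
  ⟦⟧-sound s t (normalised eq) ρ = x∙y⁻¹≈ε⇒x≈y _ _ (begin
    ⟦ s ⟧ ρ - ⟦ t ⟧ ρ
      ≈⟨ +-cong (normalise-correct s ρ) (-‿cong (normalise-correct t ρ)) ⟨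
    ⟦ normalise s ⟧ₚ ρ - ⟦ normalise t ⟧ₚ ρ
      ≈⟨ +-congˡ (⊟-hom (normalise t) ρ) ⟨
    ⟦ normalise s ⟧ₚ ρ + ⟦ ⊟ normalise t ⟧ₚ ρ
      ≈⟨ ⊞-hom (normalise s) (⊟ normalise t) ρ ⟨
    ⟦ normalise s ⊞ ⊟ normalise t ⟧ₚ ρ
      ≈⟨ HornerLemmas.zero-hom homomorphism (normalise s ⊞ ⊟ normalise t) eq ρ ⟨
    0# ∎)

-- The quartic forms and the matrices as terms

module TermForms {n : ℕ} where
  open RingNotation (termRing n)
  open QuarticForms (termRing n) public using (generalForm; fastForm)
  open Matrices (termRing n) 4 public using (Matrix; identity; _⊗_)

  -- Repeats `coefficients`, which is tied to a field, clause by clause: evaluated at the branch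
  -- points in `K`, it unfolds to the coefficients in `𝒦ᵍᵉⁿ`.
  branchCoefficients : (ρ σ τ : Term n) → ℕ → Term n
  branchCoefficients ρ σ τ = coefficients (0# ∷ 1# ∷ ρ ∷ σ ∷ τ ∷ [])
    where
    coefficients : List (Term n) → ℕ → Term n
    coefficients []       zero    = 1#
    coefficients []       (suc i) = 0#
    coefficients (r ∷ rs) zero    = - (r * coefficients rs zero)
    coefficients (r ∷ rs) (suc i) = coefficients rs i - r * coefficients rs (suc i)

  -- The fast form times `δF * δG * δH`, provided `NE`, ..., `NH` are the numerators of `E`, ...,
  -- `H`.
  fastNumerator : (δF δG δH NE NF NG NH X Y Z T : Term n) → Term n
  fastNumerator δF δG δH NE NF NG NH X Y Z T =
      δF * δG * δH * (X ^ 4 + Y ^ 4 + Z ^ 4 + T ^ 4)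
    - δG * δH * NF * (X ^ 2 * T ^ 2 + Y ^ 2 * Z ^ 2)
    - δF * δH * NG * (X ^ 2 * Z ^ 2 + Y ^ 2 * T ^ 2)
    - δF * δG * NH * (X ^ 2 * Y ^ 2 + Z ^ 2 * T ^ 2)
    + 2 · NE * X * Y * Z * T

  -- e f₄ = φ₄, e² f₃ = φ₃ and e² f₂ = g φ₂ for the coefficients fᵢ of 𝒟.
  module Scales (n₁ n₂ A B C D : Term n) where
    e g φ₂ φ₃ φ₄ : Term n
    e = n₁ * A * B
    g = n₂ * C * D
    φ₂ = - (n₁ * (B * C + A * D) + n₂ * (A * B + C * D))
    φ₃ = (n₁ ^ 2 + n₂ ^ 2) * (A * B * C * D) + n₁ * n₂ * (A * B + C * D) * (B * C + A * D)
    φ₄ = - (n₁ * (A * B + C * D) + n₂ * (B * C + A * D))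

    module Coordinates (u v p q : Term n) where
      k : Fin 4 → Term n
      k 0F = e ^ 2 * (u - v)
      k 1F = e * (p + q)
      k 2F = e * g * (u + v)
      k 3F = g * (p - q)

      -- The general form at `k`, divided by `(e * g) ^ 2`. With `f₅ = 1` and `e² f₁ = g²` its terms
      -- pair up: `(u - v)²` and `(u + v)²` to `2U`, `(p - q)²` and `(p + q)²` to `2(p² + q²)`.
      U V W reducedForm : Term n
      U = u ^ 2 + v ^ 2
      V = p ^ 2 - q ^ 2
      W = u ^ 2 - v ^ 2
      reducedForm =
          (V - φ₃ * W) ^ 2
        - (4 · e * g) * ( U * (V + φ₃ * W)
                        + W * ( 2 · (p ^ 2 + q ^ 2) + φ₂ * φ₄ * W
                              + (2 · (φ₂ + φ₄)) * (p * u) + (2 · (φ₂ - φ₄)) * (q * v) )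
                        - e * g * U ^ 2 )

  module Squares (a b c d : Term n) where
    A B C D n₁ n₂ : Term n
    A = a ^ 2 + b ^ 2 + c ^ 2 + d ^ 2
    B = a ^ 2 + b ^ 2 - c ^ 2 - d ^ 2
    C = a ^ 2 - b ^ 2 + c ^ 2 - d ^ 2
    D = a ^ 2 - b ^ 2 - c ^ 2 + d ^ 2
    n₁ = a * c - b * d
    n₂ = a * c + b * d

  -- The identities about P hold with n₁, n₂, A, B, C, D as independent variables.
  module Change (n₁ n₂ A B C D a b c d : Term n) where
    open Scales n₁ n₂ A B C D public

    m₁ m₂ m₃ m₄ δF δG δH NE NF NG NH : Term n
    m₁ = c ^ 2 * (a ^ 4 + b ^ 4 - c ^ 4 + d ^ 4) - 2 · a ^ 2 * b ^ 2 * d ^ 2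
    m₂ = d ^ 2 * (a ^ 4 + b ^ 4 + c ^ 4 - d ^ 4) - 2 · a ^ 2 * b ^ 2 * c ^ 2
    m₃ = a ^ 2 * (a ^ 4 - b ^ 4 - c ^ 4 - d ^ 4) + 2 · b ^ 2 * c ^ 2 * d ^ 2
    m₄ = b ^ 2 * (a ^ 4 - b ^ 4 + c ^ 4 + d ^ 4) - 2 · a ^ 2 * c ^ 2 * d ^ 2
    δF = a ^ 2 * d ^ 2 - b ^ 2 * c ^ 2
    δG = a ^ 2 * c ^ 2 - b ^ 2 * d ^ 2
    δH = a ^ 2 * b ^ 2 - c ^ 2 * d ^ 2
    NE = a * b * c * d * A * B * C * D
    NF = a ^ 4 - b ^ 4 - c ^ 4 + d ^ 4
    NG = a ^ 4 - b ^ 4 + c ^ 4 - d ^ 4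
    NH = a ^ 4 + b ^ 4 - c ^ 4 - d ^ 4

    matrix : Vec (Vec (Term n) 4) 4 → Matrix
    matrix rows i j = lookup (lookup rows i) j

    -- Rows 0 and 2 of `Q` solve the block in `(X , Z)` by Cramer's rule, rows 1 and 3 the block in
    -- `(Y , T)`, up to the common factor `denominator`.
    P Q : Matrix
    P = matrix (
      (    c * n₁ ^ 2 * A ^ 2 * B ^ 2   ∷ - (d * n₁ ^ 2 * A ^ 2 * B ^ 2)
        ∷ - (a * n₁ ^ 2 * A ^ 2 * B ^ 2) ∷    b * n₁ ^ 2 * A ^ 2 * B ^ 2  ∷ [] ) ∷
      (   (2 · a * n₁ * A * B * m₁)     ∷   (2 · b * n₁ * A * B * m₂)
        ∷ - (2 · c * n₁ * A * B * m₃)   ∷   (2 · d * n₁ * A * B * m₄)     ∷ [] ) ∷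
      (    c * n₁ * n₂ * A * B * C * D   ∷    d * n₁ * n₂ * A * B * C * D
        ∷ - (a * n₁ * n₂ * A * B * C * D) ∷ - (b * n₁ * n₂ * A * B * C * D) ∷ [] ) ∷
      (   (2 · a * n₂ * C * D * m₁)     ∷ - (2 · b * n₂ * C * D * m₂)
        ∷ - (2 · c * n₂ * C * D * m₃)   ∷ - (2 · d * n₂ * C * D * m₄)     ∷ [] ) ∷ [])

    Q = matrix (
      (2 · c * m₃ * g     ∷ - (a * e * g) ∷ 2 · c * m₃ * e     ∷ - (a * e ^ 2) ∷ []) ∷
      (- (2 · d * m₄ * g) ∷ b * e * g     ∷ 2 · d * m₄ * e     ∷ - (b * e ^ 2) ∷ []) ∷
      (2 · a * m₁ * g     ∷ - (c * e * g) ∷ 2 · a * m₁ * e     ∷ - (c * e ^ 2) ∷ []) ∷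
      (2 · b * m₂ * g     ∷ d * e * g     ∷ - (2 · b * m₂ * e) ∷ - (d * e ^ 2) ∷ []) ∷ [])

    -- `4 δF δH` is the determinant of either block up to sign, a further 2 comes from
    -- `(u + v) + (u - v) = 2u` and its analogues, and `e² g` is a common multiple of the scalings
    -- `e²`, `e`, `e g`, `g` in `k`.
    denominator : Term n
    denominator = 8 · e ^ 2 * g * δF * δH

    module Variables (X Y Z T : Term n) where
      u v p q : Term n
      u = c * X - a * Z
      v = d * Y - b * T
      p = (2 · a * m₁) * X - (2 · c * m₃) * Z
      q = (2 · b * m₂) * Y + (2 · d * m₄) * T
      open Coordinates u v p q public using (k; reducedForm)

-- The identities between integer polynomials

∀₄ : ∀ {p} {P : Fin 4 → Set p} → P 0F → P 1F → P 2F → P 3F → ∀ i → P i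
∀₄ p₀ p₁ p₂ p₃ 0F = p₀
∀₄ p₀ p₁ p₂ p₃ 1F = p₁
∀₄ p₀ p₁ p₂ p₃ 2F = p₂
∀₄ p₀ p₁ p₂ p₃ 3F = p₃

module MatrixIdentities where
  open RingNotation (termRing 10)
  open TermForms {10}
  open Change (var 0F) (var 1F) (var 2F) (var 3F) (var 4F)
              (var 5F) (var 6F) (var 7F) (var 8F) (var 9F) public

  P⊗Q : ∀ i j → (P ⊗ Q) i j ≋ denominator * identity i j
  -- With both indices concrete the terms can be normalised, and `Zero` computes to the unit type,
  -- which `_` fills.
  P⊗Q = ∀₄
    (∀₄ (normalised _) (normalised _) (normalised _) (normalised _))
    (∀₄ (normalised _) (normalised _) (normalised _) (normalised _))
    (∀₄ (normalised _) (normalised _) (normalised _) (normalised _))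
    (∀₄ (normalised _) (normalised _) (normalised _) (normalised _))

  Q⊗P : ∀ i j → (Q ⊗ P) i j ≋ denominator * identity i j
  Q⊗P = ∀₄
    (∀₄ (normalised _) (normalised _) (normalised _) (normalised _))
    (∀₄ (normalised _) (normalised _) (normalised _) (normalised _))
    (∀₄ (normalised _) (normalised _) (normalised _) (normalised _))
    (∀₄ (normalised _) (normalised _) (normalised _) (normalised _))

  two scale : Term 10
  two = 1# + 1#
  -- `(e * g) ^ 2` is split off by `generalForm-reduced`; the rest is `-256 δF³ δG δH³`, from
  -- `reducedForm-fast` and the cleared denominators of the fast form.
  scale = - ((e * g) ^ 2 * ((4 · 4 · δF * δH) ^ 2 * (δF * δG * δH)))

  -- Displays `denominator` as a product of factors known to be nonzero, with 8 as a power of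
  -- `1# + 1#`. `scale-factors` does the same for 256.
  denominator-factors : two ^ 3 * (e ^ 2 * g * (δF * δH)) ≋ denominator
  denominator-factors = normalised _

  scale-factors : - 1# * ((two ^ 4 * (e * g * (δF * δH))) ^ 2 * (δF * δG * δH)) ≋ scale
  scale-factors = normalised _

module CoordinateIdentity where
  open RingNotation (termRing 14)
  open TermForms {14}
  open Change (var 0F) (var 1F) (var 2F) (var 3F) (var 4F)
              (var 5F) (var 6F) (var 7F) (var 8F) (var 9F)

  X Y Z T : Term 14
  X = var (# 10)
  Y = var (# 11)
  Z = var (# 12)
  T = var (# 13)
  open Variables X Y Z T public

  -- The nesting and the final `0#` are those of an unfolded `sum` over `Fin 4`, so that the
  -- evaluated identity applies to the rows of `P` directly.
  P-coordinates : ∀ i → P i 0F * X + (P i 1F * Y + (P i 2F * Z + (P i 3F * T + 0#))) ≋ k i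
  P-coordinates = ∀₄ (normalised _) (normalised _) (normalised _) (normalised _)

module GeneralFormIdentity where
  open RingNotation (termRing 10)
  open TermForms {10}

  n₁ A B x y ν u v p q : Term 10
  n₁ = var 0F
  A = var 1F
  B = var 2F
  x = var 3F
  y = var 4F
  ν = var 5F
  u = var 6F
  v = var 7F
  p = var 8F
  q = var 9F

  -- With `n₂ = n₁ν`, `C = Ax`, `D = By` the branch points become polynomials, and no division is
  -- left.
  open Scales n₁ (n₁ * ν) A B (A * x) (B * y)
  open Coordinates u v p q

  f : ℕ → Term 10
  f = branchCoefficients (x * y) (ν * x) (ν * y)

  generalForm-reduced :
    generalForm (f 0) (f 1) (f 2) (f 3) (f 4) (f 5) 0# (k 0F) (k 1F) (k 2F) (k 3F)
      ≋ (e * g) ^ 2 * reducedForm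
  generalForm-reduced = normalised _

module ReducedFormIdentity where
  open RingNotation (termRing 8)
  open TermForms {8}

  X Y Z T a b c d : Term 8
  X = var 0F
  Y = var 1F
  Z = var 2F
  T = var 3F
  a = var 4F
  b = var 5F
  c = var 6F
  d = var 7F
  open Squares a b c d public
  open Change n₁ n₂ A B C D a b c d public
  open Variables X Y Z T using (reducedForm)

  factor : Term 8
  factor = (4 · 4 · δF * δH) ^ 2

  -- The only identity into which the relations of `n₁`, ..., `D` to `a`, ..., `d` enter, among them
  -- `n₁n₂ = δG`, `AB - CD = 4 δH` and `AD - BC = 4 δF`.
  reducedForm-fast :
    reducedForm ≋ - (factor * fastNumerator δF δG δH NE NF NG NH X Y Z T)
  reducedForm-fast = normalised _

module FastFormIdentity where
  open RingNotation (termRing 12)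
  open TermForms {12}

  s δF δG δH E F G H X Y Z T : Term 12
  s = var 0F
  δF = var 1F
  δG = var 2F
  δH = var 3F
  E = var 4F
  F = var 5F
  G = var 6F
  H = var 7F
  X = var 8F
  Y = var 9F
  Z = var (# 10)
  T = var (# 11)

  -- `s` stands for `e * g`. Each numerator is entered as denominator times coefficient, so that
  -- `δF * δG * δH` factors out.
  fastNumerator-fastForm :
    s ^ 2 * - ((4 · 4 · δF * δH) ^ 2
                * fastNumerator δF δG δH (δF * δG * δH * E) (δF * F) (δG * G) (δH * H) X Y Z T)
      ≋ - (s ^ 2 * ((4 · 4 · δF * δH) ^ 2 * (δF * δG * δH))) * fastForm E F G H X Y Z T
  fastNumerator-fastForm = normalised _

module GenericForms where
  open TermForms

  -- All arguments are independent variables: evaluation computes to the form at arbitrary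
  -- polynomials, each of which `⟦⟧-cong` can replace.
  general : Term 10
  general = generalForm (var 0F) (var 1F) (var 2F) (var 3F) (var 4F) (var 5F) zero
                        (var 6F) (var 7F) (var 8F) (var 9F)

  numerator : Term 11
  numerator = fastNumerator (var 0F) (var 1F) (var 2F) (var 3F) (var 4F) (var 5F)
                            (var 6F) (var 7F) (var 8F) (var 9F) (var (# 10))

  open Scales {10} (var 0F) (var 1F) (var 2F) (var 3F) (var 4F) (var 5F) public
  open Coordinates (var 6F) (var 7F) (var 8F) (var 9F) public using (k; reducedForm)

  scaledReducedForm : Term 10
  scaledReducedForm = (e * g) ^ 2 * reducedForm
    where open RingNotation (termRing 10)

-- Constants of the polynomial ring

module ConstantTerms {r ℓ} (R : CommutativeRing r ℓ) (m : ℕ) where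
  open PolynomialRing R m
  private
    module R = CommutativeRing R
    module E = Evaluation R
    module EX = Evaluation polynomialRing
  open RingProperties (CommutativeRing.ring polynomialRing) using (+-inverseˡ-unique)

  con-⟦⟧ : ∀ {n} (t : Term n) ρ → con (E.⟦ t ⟧ ρ) ≈ₚ EX.⟦ t ⟧ (Vec.map con ρ)
  con-⟦⟧ zero      ρ = refl
  con-⟦⟧ one       ρ = refl
  con-⟦⟧ (var i)   ρ rewrite Vec.lookup-map i con ρ = refl
  con-⟦⟧ (add s t) ρ = trans (con-+-homo _ _) (+-cong (con-⟦⟧ s ρ) (con-⟦⟧ t ρ))
  con-⟦⟧ (mul s t) ρ = trans (con-*-homo _ _) (*-cong (con-⟦⟧ s ρ) (con-⟦⟧ t ρ))
  -- `con (- x)` is an additive inverse of `con x`, and such inverses are unique.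
  con-⟦⟧ (neg t)   ρ = trans
    (+-inverseˡ-unique _ _ (trans (sym (con-+-homo _ _)) (con-cong (R.-‿inverseˡ _))))
    (-‿cong (con-⟦⟧ t ρ))

  con-≈ : ∀ {n} (s t : Term n) ρ → E.⟦ s ⟧ ρ R.≈ E.⟦ t ⟧ ρ →
          EX.⟦ s ⟧ (Vec.map con ρ) ≈ₚ EX.⟦ t ⟧ (Vec.map con ρ)
  con-≈ s t ρ eq = trans (sym (con-⟦⟧ s ρ)) (trans (con-cong eq) (con-⟦⟧ t ρ))

-- Matrix inverses and quotients

module ScaledInverse {r ℓ} (R : CommutativeRing r ℓ) (n : ℕ) where
  open CommutativeRing R
  open Matrices R n
  open Sums semiring using (sum; sum-cong-≋; *-distribˡ-sum)
  open CommutativeSemigroupProperties *-commutativeSemigroup using (x∙yz≈y∙xz)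
  open ≈-Reasoning setoid

  module _ {t r : Carrier} (rt≈1 : r * t ≈ 1#) (M N : Matrix) where

    private
      unit : ∀ x → r * (t * x) ≈ x
      unit x = trans (sym (*-assoc r t x)) (trans (*-congʳ rt≈1) (*-identityˡ x))

    scaled-inverse : (∀ i j → (M ⊗ N) i j ≈ t * identity i j) →
                     (∀ i j → (N ⊗ M) i j ≈ t * identity i j) →
                     AreInverse M (λ i j → r * N i j)
    scaled-inverse MN≈t NM≈t = (λ i j → begin
      sum (λ k → M i k * (r * N k j))  ≈⟨ sum-cong-≋ (λ k → x∙yz≈y∙xz (M i k) r (N k j)) ⟩
      sum (λ k → r * (M i k * N k j))  ≈⟨ *-distribˡ-sum r (λ k → M i k * N k j) ⟨
      r * (M ⊗ N) i j                  ≈⟨ *-congˡ (MN≈t i j) ⟩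
      r * (t * identity i j)           ≈⟨ unit (identity i j) ⟩
      identity i j                     ∎) , λ i j → begin
      sum (λ k → r * N i k * M k j)    ≈⟨ sum-cong-≋ (λ k → *-assoc r (N i k) (M k j)) ⟩
      sum (λ k → r * (N i k * M k j))  ≈⟨ *-distribˡ-sum r (λ k → N i k * M k j) ⟨
      r * (N ⊗ M) i j                  ≈⟨ *-congˡ (NM≈t i j) ⟩
      r * (t * identity i j)           ≈⟨ unit (identity i j) ⟩
      identity i j                     ∎

module Quotients {k ℓ₁ ℓ₂} (K : HeytingField k ℓ₁ ℓ₂) where
  open Kummer K
  open HeytingProperties heytingCommutativeRing using (x-0≈x; invertibleˡ⇒#; #-congʳ)
  open CommutativeSemigroupProperties *-commutativeSemigroup using (x∙yz≈y∙xz)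
  open ≈-Reasoning setoid

  reciprocalˡ : ∀ {x} (x#0 : x # 0#) → reciprocal x#0 * x ≈ 1#
  reciprocalˡ {x} x#0 = trans (*-congˡ (sym (x-0≈x x))) (proj₁ (proj₂ (#⇒invertible x#0)))

  *-/-cancel : ∀ {x y} (y#0 : y # 0#) → y * (x / y [ y#0 ]) ≈ x
  *-/-cancel {x} {y} y#0 = begin
    y * (x * reciprocal y#0)  ≈⟨ x∙yz≈y∙xz y x _ ⟩
    x * (y * reciprocal y#0)  ≈⟨ *-congˡ (trans (*-comm y _) (reciprocalˡ y#0)) ⟩
    x * 1#                    ≈⟨ *-identityʳ x ⟩
    x                         ∎

  /-unique : ∀ {x y z} (y#0 : y # 0#) → y * z ≈ x → x / y [ y#0 ] ≈ z
  /-unique {x} {y} {z} y#0 yz≈x = begin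
    x * reciprocal y#0        ≈⟨ *-comm x _ ⟩
    reciprocal y#0 * x        ≈⟨ *-congˡ yz≈x ⟨
    reciprocal y#0 * (y * z)  ≈⟨ *-assoc _ y z ⟨
    reciprocal y#0 * y * z    ≈⟨ *-congʳ (reciprocalˡ y#0) ⟩
    1# * z                    ≈⟨ *-identityˡ z ⟩
    z                         ∎

  #0-factorˡ : ∀ {x y} → x * y # 0# → x # 0#
  #0-factorˡ {x} {y} xy#0 = invertibleˡ⇒# (reciprocal xy#0 * y , (begin
    reciprocal xy#0 * y * (x - 0#)  ≈⟨ *-congˡ (x-0≈x x) ⟩
    reciprocal xy#0 * y * x         ≈⟨ *-assoc _ y x ⟩
    reciprocal xy#0 * (y * x)       ≈⟨ *-congˡ (*-comm y x) ⟩
    reciprocal xy#0 * (x * y)       ≈⟨ reciprocalˡ xy#0 ⟩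
    1#                              ∎))

  #0-factorʳ : ∀ {x y} → x * y # 0# → y # 0#
  #0-factorʳ {x} {y} xy#0 = #0-factorˡ (#-congʳ (*-comm x y) xy#0)

  -1#0 : - 1# # 0#
  -1#0 = invertibleˡ⇒# (- 1# , trans (*-congˡ (x-0≈x (- 1#))) (trans (-1*x≈-x (- 1#)) (-‿involutive 1#)))
    where open RingProperties ring using (-1*x≈-x; -‿involutive)

-- The map between the two Kummer surfaces

module KummerMap {k ℓ₁ ℓ₂} (K : HeytingField k ℓ₁ ℓ₂) where
  open Kummer K
  open HeytingProperties heytingCommutativeRing using (x#0y#0→xy#0; #-congʳ)
  open Quotients K
  open ScaledInverse commutativeRing 4 using (scaled-inverse)
  open ConstantTerms commutativeRing 4 using (con-⟦⟧; con-≈)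
  open PolynomialRing commutativeRing 4 using (con-cong)
  open Sums semiring using (sum-cong-≋)
  open CommutativeSemigroupProperties *-commutativeSemigroup using (interchange)
  private
    module E = Evaluation commutativeRing
    module EX = Evaluation polynomialRing
    module KX = RingNotation polynomialRing
    module Generic = GenericForms
    module M = MatrixIdentities
    module R = ReducedFormIdentity
    open CoordinateIdentity using (P-coordinates)

  module Proof (2#0 : Characteristic≢2) (a b c d : Carrier)
               (nondegenerate : Parameters.NonDegenerate a b c d) where
    open Parameters a b c d
    open NonDegenerate nondegenerate
    open Surfaces nondegenerate

    infixl 7 _·#0_
    _·#0_ : ∀ {x y} → x # 0# → y # 0# → x * y # 0#
    _·#0_ = x#0y#0→xy#0

    ρ#0 : ρ # 0#
    ρ#0 with distinct
    ... | (_ ∷ 0#ρ ∷ _) ∷ _ = #-sym 0#ρ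

    σ#0 : σ # 0#
    σ#0 with distinct
    ... | (_ ∷ _ ∷ 0#σ ∷ _) ∷ _ = #-sym 0#σ

    CD#0 : C * D # 0#
    CD#0 = #0-factorˡ ρ#0

    e#0 : n₁ * A * B # 0#
    e#0 = n₁#0 ·#0 A#0 ·#0 B#0

    -- `n₂`, `C` and `D` are factors of the numerators of `σ` and `ρ`, which are nonzero because 0
    -- is another branch point.
    g#0 : n₂ * C * D # 0#
    g#0 = #0-factorˡ (#0-factorˡ σ#0) ·#0 #0-factorˡ CD#0 ·#0 #0-factorʳ CD#0

    parameters : Vec Carrier 10
    parameters = n₁ ∷ n₂ ∷ A ∷ B ∷ C ∷ D ∷ a ∷ b ∷ c ∷ d ∷ []

    denominator scale : Carrier
    denominator = E.⟦ M.denominator ⟧ parameters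
    scale = E.⟦ M.scale ⟧ parameters

    denominator#0 : denominator # 0#
    denominator#0 = #-congʳ (E.⟦⟧-sound _ _ M.denominator-factors parameters)
      (2#0 ·#0 2#0 ·#0 2#0 ·#0 (e#0 ·#0 e#0 ·#0 g#0 ·#0 (δF#0 ·#0 δH#0)))

    scale#0 : scale # 0#
    scale#0 = #-congʳ (E.⟦⟧-sound _ _ M.scale-factors parameters)
      (-1#0 ·#0 ((root#0 ·#0 root#0) ·#0 (δF#0 ·#0 δG#0 ·#0 δH#0)))
      where
      root#0 = 2#0 ·#0 2#0 ·#0 2#0 ·#0 2#0 ·#0 (e#0 ·#0 g#0 ·#0 (δF#0 ·#0 δH#0))

    P-entry : ∀ i j → E.⟦ M.P i j ⟧ parameters ≈ P i j
    P-entry = ∀₄ (∀₄ refl refl refl refl) (∀₄ refl refl refl refl)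
                 (∀₄ refl refl refl refl) (∀₄ refl refl refl refl)

    identity-entry : ∀ i j → E.⟦ TermForms.identity i j ⟧ parameters ≈ identity i j
    identity-entry = ∀₄ (∀₄ refl refl refl refl) (∀₄ refl refl refl refl)
                        (∀₄ refl refl refl refl) (∀₄ refl refl refl refl)

    Q P⁻¹ : Matrix
    Q i j = E.⟦ M.Q i j ⟧ parameters
    P⁻¹ i j = reciprocal denominator#0 * Q i j

    P⁻¹-inverse : AreInverse P P⁻¹
    P⁻¹-inverse = scaled-inverse (reciprocalˡ denominator#0) P Q
      (λ i j → trans (sum-cong-≋ (λ k → *-congʳ {Q k j} (sym (P-entry i k)))) (scalar i j (M.P⊗Q i j)))
      (λ i j → trans (sum-cong-≋ (λ k → *-congˡ {Q i k} (sym (P-entry k j)))) (scalar i j (M.Q⊗P i j)))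
      where
      scalar : ∀ i j {t} → t ≋ mul M.denominator (TermForms.identity i j) →
               E.⟦ t ⟧ parameters ≈ denominator * identity i j
      scalar i j t≋ = trans (E.⟦⟧-sound _ _ t≋ parameters) (*-congˡ (identity-entry i j))

    x y ν : Carrier
    x = C / A [ A#0 ]
    y = D / B [ B#0 ]
    ν = n₂ / n₁ [ n₁#0 ]

    -- A `reciprocal` is taken with respect to a proof of apartness; by `/-unique` any proof for
    -- `p * q` will do.
    quotient-product : ∀ {p q r s} (p#0 : p # 0#) (q#0 : q # 0#) (pq#0 : p * q # 0#) →
      r * s / p * q [ pq#0 ] ≈ (r / p [ p#0 ]) * (s / q [ q#0 ])
    quotient-product p#0 q#0 pq#0 = /-unique pq#0
      (trans (interchange _ _ _ _) (*-cong (*-/-cancel p#0) (*-/-cancel q#0)))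

    ρ≈xy : ρ ≈ x * y
    ρ≈xy = quotient-product A#0 B#0 _

    σ≈νx : σ ≈ ν * x
    σ≈νx = quotient-product n₁#0 A#0 _

    τ≈νy : τ ≈ ν * y
    τ≈νy = quotient-product n₁#0 B#0 _

    con-product : ∀ {r s t} → r * s ≈ t → con t ≈ₚ con r KX.* con s
    con-product {r} {s} rs≈t =
      KX.sym (con-≈ (mul (var 0F) (var 1F)) (var 2F) (r ∷ s ∷ _ ∷ []) rs≈t)

    X Y Z T u v p q e·g : Poly
    X = var 0F
    Y = var 1F
    Z = var 2F
    T = var 3F
    e·g = con n₁ KX.* con A KX.* con B KX.* (con n₂ KX.* con C KX.* con D)

    matrixValues : Vec Poly 14
    matrixValues = Vec.map con parameters ++ X ∷ Y ∷ Z ∷ T ∷ []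

    u = EX.⟦ CoordinateIdentity.u ⟧ matrixValues
    v = EX.⟦ CoordinateIdentity.v ⟧ matrixValues
    p = EX.⟦ CoordinateIdentity.p ⟧ matrixValues
    q = EX.⟦ CoordinateIdentity.q ⟧ matrixValues

    baseValues : Vec Poly 8
    baseValues = X ∷ Y ∷ Z ∷ T ∷ con a ∷ con b ∷ con c ∷ con d ∷ []

    -- The same constants in three guises: as they stand; with `n₂`, `C`, `D` as products, to fit
    -- `generalForm-reduced`; expanded in `a`, ..., `d`, to fit `reducedForm-fast`.
    coordinateValues productValues expandedValues : Vec Poly 10
    coordinateValues =
        con n₁ ∷ con n₂ ∷ con A ∷ con B ∷ con C ∷ con D
      ∷ u ∷ v ∷ p ∷ q ∷ []
    productValues =
        con n₁ ∷ con n₁ KX.* con ν ∷ con A ∷ con B ∷ con A KX.* con x ∷ con B KX.* con y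
      ∷ u ∷ v ∷ p ∷ q ∷ []
    expandedValues =
        EX.⟦ R.n₁ ⟧ baseValues ∷ EX.⟦ R.n₂ ⟧ baseValues
      ∷ EX.⟦ R.A ⟧ baseValues ∷ EX.⟦ R.B ⟧ baseValues ∷ EX.⟦ R.C ⟧ baseValues ∷ EX.⟦ R.D ⟧ baseValues
      ∷ u ∷ v ∷ p ∷ q ∷ []

    coordinateValues≈productValues : Pointwise _≈ₚ_ coordinateValues productValues
    coordinateValues≈productValues =
        KX.refl ∷ con-product (*-/-cancel n₁#0)
      ∷ KX.refl ∷ KX.refl ∷ con-product (*-/-cancel A#0) ∷ con-product (*-/-cancel B#0)
      ∷ KX.refl ∷ KX.refl ∷ KX.refl ∷ KX.refl ∷ []

    coordinateValues≈expandedValues : Pointwise _≈ₚ_ coordinateValues expandedValues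
    coordinateValues≈expandedValues =
        expand S.n₁ ∷ expand S.n₂ ∷ expand S.A ∷ expand S.B ∷ expand S.C ∷ expand S.D
      ∷ KX.refl ∷ KX.refl ∷ KX.refl ∷ KX.refl ∷ []
      where
      module S = TermForms.Squares {4} (var 0F) (var 1F) (var 2F) (var 3F)
      expand : ∀ t → con (E.⟦ t ⟧ (a ∷ b ∷ c ∷ d ∷ [])) ≈ₚ EX.⟦ t ⟧ (con a ∷ con b ∷ con c ∷ con d ∷ [])
      expand t = con-⟦⟧ t (a ∷ b ∷ c ∷ d ∷ [])

    P-row : Fin 4 → Poly
    P-row i = KX.sum (λ j → con (P i j) :* var j)

    P-row≈k : ∀ i → P-row i ≈ₚ EX.⟦ Generic.k i ⟧ productValues
    P-row≈k i = begin
      P-row i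
        ≈⟨ Sums.sum-cong-≋ KX.semiring (λ j → KX.*-congʳ {var j}
             (KX.trans (con-cong (sym (P-entry i j))) (con-⟦⟧ (M.P i j) parameters))) ⟩
      KX.sum (λ j → EX.⟦ M.P i j ⟧ (Vec.map con parameters) :* var j)
        ≈⟨ coordinates i ⟩
      EX.⟦ Generic.k i ⟧ coordinateValues
        ≈⟨ EX.⟦⟧-cong (Generic.k i) coordinateValues≈productValues ⟩
      EX.⟦ Generic.k i ⟧ productValues ∎
      where
      open ≈-Reasoning KX.setoid
      coordinates : ∀ i → KX.sum (λ j → EX.⟦ M.P i j ⟧ (Vec.map con parameters) :* var j)
                          ≈ₚ EX.⟦ Generic.k i ⟧ coordinateValues
      coordinates = ∀₄
        (EX.⟦⟧-sound _ _ (P-coordinates 0F) matrixValues)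
        (EX.⟦⟧-sound _ _ (P-coordinates 1F) matrixValues)
        (EX.⟦⟧-sound _ _ (P-coordinates 2F) matrixValues)
        (EX.⟦⟧-sound _ _ (P-coordinates 3F) matrixValues)

    coefficient : ℕ → Term 3
    coefficient = TermForms.branchCoefficients (var 0F) (var 1F) (var 2F)

    f : ℕ → Poly
    f i = EX.⟦ coefficient i ⟧ (con x KX.* con y ∷ con ν KX.* con x ∷ con ν KX.* con y ∷ [])

    coefficient≈f : ∀ i → con (E.⟦ coefficient i ⟧ (ρ ∷ σ ∷ τ ∷ [])) ≈ₚ f i
    coefficient≈f i = KX.trans (con-⟦⟧ (coefficient i) (ρ ∷ σ ∷ τ ∷ []))
      (EX.⟦⟧-cong (coefficient i)
        (con-product (sym ρ≈xy) ∷ con-product (sym σ≈νx) ∷ con-product (sym τ≈νy) ∷ []))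

    numeratorValues clearedValues : Vec Poly 11
    numeratorValues =
        EX.⟦ R.δF ⟧ baseValues ∷ EX.⟦ R.δG ⟧ baseValues ∷ EX.⟦ R.δH ⟧ baseValues
      ∷ EX.⟦ R.NE ⟧ baseValues ∷ EX.⟦ R.NF ⟧ baseValues ∷ EX.⟦ R.NG ⟧ baseValues ∷ EX.⟦ R.NH ⟧ baseValues
      ∷ X ∷ Y ∷ Z ∷ T ∷ []
    clearedValues =
        DF ∷ DG ∷ DH
      ∷ DF KX.* DG KX.* DH KX.* con E ∷ DF KX.* con F ∷ DG KX.* con G ∷ DH KX.* con H
      ∷ X ∷ Y ∷ Z ∷ T ∷ []
      where
      DF = EX.⟦ R.δF ⟧ baseValues
      DG = EX.⟦ R.δG ⟧ baseValues
      DH = EX.⟦ R.δH ⟧ baseValues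

    numeratorValues≈clearedValues : Pointwise _≈ₚ_ numeratorValues clearedValues
    numeratorValues≈clearedValues =
        KX.refl ∷ KX.refl ∷ KX.refl
      ∷ clear R.NE (mul (mul (mul R.δF R.δG) R.δH) (var 0F)) (*-/-cancel _)
      ∷ clear R.NF (mul R.δF (var 1F)) (*-/-cancel δF#0)
      ∷ clear R.NG (mul R.δG (var 2F)) (*-/-cancel δG#0)
      ∷ clear R.NH (mul R.δH (var 3F)) (*-/-cancel δH#0)
      ∷ KX.refl ∷ KX.refl ∷ KX.refl ∷ KX.refl ∷ []
      where
      -- E, F, G, H take the places of X, Y, Z, T, which δF, …, NH do not involve.
      values : Vec Carrier 8
      values = E ∷ F ∷ G ∷ H ∷ a ∷ b ∷ c ∷ d ∷ []
      clear : ∀ s t → E.⟦ t ⟧ values ≈ E.⟦ s ⟧ values →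
              EX.⟦ s ⟧ (Vec.map con values) ≈ₚ EX.⟦ t ⟧ (Vec.map con values)
      clear s t t≈s = KX.sym (con-≈ t s values t≈s)

    -- The map has matrix `P⁻¹`, so the equation is transported by substituting the inverse of that
    -- matrix, `P` itself.
    𝒦ᵍᵉⁿ∘P≈scale*𝒦ᶠᵃˢᵗ : 𝒦ᵍᵉⁿ ∘ˡ P ≈ₚ con scale :* 𝒦ᶠᵃˢᵗ
    𝒦ᵍᵉⁿ∘P≈scale*𝒦ᶠᵃˢᵗ = begin
      𝒦ᵍᵉⁿ ∘ˡ P
        -- `𝒦ᵍᵉⁿ ∘ˡ P` unfolds to `general` at the constant coefficients and the rows of `P`.
        ≈⟨ EX.⟦⟧-cong Generic.general
             ( coefficient≈f 0 ∷ coefficient≈f 1 ∷ coefficient≈f 2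
             ∷ coefficient≈f 3 ∷ coefficient≈f 4 ∷ coefficient≈f 5
             ∷ P-row≈k 0F ∷ P-row≈k 1F ∷ P-row≈k 2F ∷ P-row≈k 3F ∷ []) ⟩
      EX.⟦ Generic.general ⟧ (f 0 ∷ f 1 ∷ f 2 ∷ f 3 ∷ f 4 ∷ f 5 ∷ kₚ 0F ∷ kₚ 1F ∷ kₚ 2F ∷ kₚ 3F ∷ [])
        ≈⟨ EX.⟦⟧-sound _ _ GeneralFormIdentity.generalForm-reduced
             (con n₁ ∷ con A ∷ con B ∷ con x ∷ con y ∷ con ν ∷ u ∷ v ∷ p ∷ q ∷ []) ⟩
      EX.⟦ Generic.scaledReducedForm ⟧ productValues
        ≈⟨ EX.⟦⟧-cong Generic.scaledReducedForm coordinateValues≈productValues ⟨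
      e·g KX.^ 2 KX.* EX.⟦ Generic.reducedForm ⟧ coordinateValues
        ≈⟨ KX.*-congˡ {e·g KX.^ 2} (EX.⟦⟧-cong Generic.reducedForm coordinateValues≈expandedValues) ⟩
      e·g KX.^ 2 KX.* EX.⟦ Generic.reducedForm ⟧ expandedValues
        -- At `expandedValues` the form unfolds to the left side of `reducedForm-fast` at
        -- `baseValues`.
        ≈⟨ KX.*-congˡ {e·g KX.^ 2} (EX.⟦⟧-sound _ _ R.reducedForm-fast baseValues) ⟩
      e·g KX.^ 2 KX.* KX.- (factor KX.* EX.⟦ Generic.numerator ⟧ numeratorValues)
        ≈⟨ KX.*-congˡ {e·g KX.^ 2} (KX.-‿cong (KX.*-congˡ {factor}
             (EX.⟦⟧-cong Generic.numerator numeratorValues≈clearedValues))) ⟩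
      e·g KX.^ 2 KX.* KX.- (factor KX.* EX.⟦ Generic.numerator ⟧ clearedValues)
        -- With `e·g` for `s`, the constant in front unfolds to `M.scale` at the parameters.
        ≈⟨ EX.⟦⟧-sound _ _ FastFormIdentity.fastNumerator-fastForm
             ( e·g ∷ EX.⟦ R.δF ⟧ baseValues ∷ EX.⟦ R.δG ⟧ baseValues ∷ EX.⟦ R.δH ⟧ baseValues
             ∷ con E ∷ con F ∷ con G ∷ con H ∷ X ∷ Y ∷ Z ∷ T ∷ []) ⟩
      EX.⟦ M.scale ⟧ (Vec.map con parameters) KX.* 𝒦ᶠᵃˢᵗ
        ≈⟨ KX.*-congʳ {𝒦ᶠᵃˢᵗ} (con-⟦⟧ M.scale parameters) ⟨
      con scale :* 𝒦ᶠᵃˢᵗ ∎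
      where
      open ≈-Reasoning KX.setoid
      kₚ : Fin 4 → Poly
      kₚ i = EX.⟦ Generic.k i ⟧ productValues
      factor : Poly
      factor = EX.⟦ R.factor ⟧ baseValues

theorem4p1 : ∀ {k ℓ₁ ℓ₂} (K : HeytingField k ℓ₁ ℓ₂) →
    let open Kummer K in
    Characteristic≢2 →
    ∀ (a b c d : Carrier) →
    let open Parameters a b c d in
    (nondegenerate : NonDegenerate) →
    let open Surfaces nondegenerate in
    ∃ λ P⁻¹ → AreInverse P P⁻¹ × P⁻¹ isLinearMapFrom 𝒦ᵍᵉⁿ to 𝒦ᶠᵃˢᵗ
theorem4p1 K 2#0 a b c d nondegenerate =
  P⁻¹ , P⁻¹-inverse ,
  -- For the matrix `P⁻¹` the two inverse laws change places.
  Kummer.Parameters.P K a b c d , (proj₂ P⁻¹-inverse , proj₁ P⁻¹-inverse) ,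
  scale , scale#0 , 𝒦ᵍᵉⁿ∘P≈scale*𝒦ᶠᵃˢᵗ
  where open KummerMap.Proof K 2#0 a b c d nondegenerate
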